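{- For every $n\ge1$, the restriction of $\pi_\downarrow^{3412}$ is a bijection from the Baxter permutations in $S_n$ to the twisted Baxter permutations in $S_n$. Its inverse is the restriction of $\pi^\uparrow_{3412}$ (to twisted Baxter permutations).
   Context: Permutations are in one-line notation $x=x_1\cdots x_n\in S_n$. Patterns, always with $a<b<c<d$: $x$ contains 3-41-2 if it has a subsequence $c\,d\,a\,b$ with $d$ immediately before $a$ in $x$; 2-41-3 if it has a subsequence $b\,d\,a\,c$ with $d$ immediately before $a$; 3-14-2 if it has a subsequence $c\,a\,d\,b$ with $a$ immediately before $d$. A Baxter permutation is one avoiding both 3-14-2 and 2-41-3; a twisted Baxter permutation is one avoiding both 3-41-2 and 2-41-3. The weak order on $S_n$ is the partial order in which one moves up by a cover by swapping adjacent entries $x_i<x_{i+1}$; it is a lattice. A permutation $x$ is obtained from $y$ by a $(3412\to3142)$-move if $y$ has a subsequence $c\,d\,a\,b$ as in the pattern 3-41-2 and $x$ is $y$ with the adjacent entries $d,a$ swapped. $\Theta_{3412}$ is the lattice congruence on the weak order on $S_n$ such that, for a cover $x\lessdot y$, $x\equiv y$ if and only if $x$ is obtained from $y$ by a $(3412\to3142)$-move; its classes are intervals, so it is the equivalence relation generated by these moves (that it is a lattice congruence is known). $\pi_\downarrow^{3412}$ sends a permutation to the minimal element of its $\Theta_{3412}$-class, and $\pi^\uparrow_{3412}$ sends it to the maximal element of its class. -}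

module Defs where

open import Data.Fin.Base using (Fin; zero; suc; toℕ; _<_)
open import Data.Fin.Permutation
  using (Permutation′; _⟨$⟩ʳ_; _≈_; transpose; _∘ₚ_)
import Data.Fin.Permutation.Components as PC
open import Data.Fin.Properties using (toℕ-injective; toℕ<n; _≟_; _<?_; any?)
open import Data.Nat.Base as ℕ using (ℕ; zero; suc; _+_; _*_; _∸_)
import Data.Nat.Properties as ℕₚ
open import Data.Nat.Induction using (<-wellFounded)
open import Data.Nat.Tactic.RingSolver using (solve-∀)
open import Data.Product.Base using (Σ; ∃; ∃₂; _×_; _,_; proj₁; proj₂)
open import Data.Sum.Base using (_⊎_; inj₁; inj₂)
open import Function.Base using (_∘_; _on_)
open import Induction.WellFounded using (Acc; acc)
open import Level using (0ℓ)
open import Relation.Binary.Construct.Closure.Equivalence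
  using (EqClosure)
open import Relation.Binary.Construct.Closure.ReflexiveTransitive
  using (Star; ε; _◅_; _◅◅_)
open import Relation.Binary.Construct.Closure.Symmetric using (fwd; bwd)
open import Relation.Binary.Construct.Union using (_∪_)
open import Relation.Binary.Core using (Rel)
open import Relation.Binary.Definitions using (tri<; tri≈; tri>)
open import Relation.Binary.PropositionalEquality
  using (_≡_; _≢_; refl; sym; trans; cong; subst; subst₂)
open import Relation.Nullary using (¬_; Dec; yes; no; contradiction)
open import Relation.Nullary.Decidable using (_×-dec_)
open import Relation.Unary using (Pred; _∈_)

private
  variable
    n : ℕ

-- The one-line notation of x : Permutation′ n has the entry x ⟨$⟩ʳ i in
-- position i.  Two permutations are equal when _≈_ relates them; _≡_ on
-- Permutation′ n is finer (it also compares the proofs stored in the record),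
-- which is why _≈_ is added to the generating relations below.

Next : Fin n → Fin n → Set
Next i j = toℕ j ≡ suc (toℕ i)

-- `transpose i j ∘ₚ x` applies the transposition first, so it exchanges the
-- entries in *positions* i and j.
swapAt : Fin n → Fin n → Permutation′ n → Permutation′ n
swapAt i j x = transpose i j ∘ₚ x

-- An occurrence of a pattern whose adjacent pair sits in positions q, r;
-- the other two entries are in positions p < q and s > r.

Occ3-41-2 : Permutation′ n → Fin n → Fin n → Set
Occ3-41-2 x q r = Next q r × ∃₂ λ p s → p < q × r < s ×
  (x ⟨$⟩ʳ r) < (x ⟨$⟩ʳ s) × (x ⟨$⟩ʳ s) < (x ⟨$⟩ʳ p) × (x ⟨$⟩ʳ p) < (x ⟨$⟩ʳ q)

Occ2-41-3 : Permutation′ n → Fin n → Fin n → Set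
Occ2-41-3 x q r = Next q r × ∃₂ λ p s → p < q × r < s ×
  (x ⟨$⟩ʳ r) < (x ⟨$⟩ʳ p) × (x ⟨$⟩ʳ p) < (x ⟨$⟩ʳ s) × (x ⟨$⟩ʳ s) < (x ⟨$⟩ʳ q)

Occ3-14-2 : Permutation′ n → Fin n → Fin n → Set
Occ3-14-2 x q r = Next q r × ∃₂ λ p s → p < q × r < s ×
  (x ⟨$⟩ʳ q) < (x ⟨$⟩ʳ s) × (x ⟨$⟩ʳ s) < (x ⟨$⟩ʳ p) × (x ⟨$⟩ʳ p) < (x ⟨$⟩ʳ r)

Contains3-41-2 Contains2-41-3 Contains3-14-2 : Pred (Permutation′ n) 0ℓ
Contains3-41-2 x = ∃₂ (Occ3-41-2 x)
Contains2-41-3 x = ∃₂ (Occ2-41-3 x)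
Contains3-14-2 x = ∃₂ (Occ3-14-2 x)

Baxter : Pred (Permutation′ n) 0ℓ
Baxter x = ¬ Contains3-14-2 x × ¬ Contains2-41-3 x

TwistedBaxter : Pred (Permutation′ n) 0ℓ
TwistedBaxter x = ¬ Contains3-41-2 x × ¬ Contains2-41-3 x

infix 4 _⋖_ _≤ʷ_

_⋖_ : Rel (Permutation′ n) 0ℓ
x ⋖ y = ∃₂ λ i j → Next i j × (x ⟨$⟩ʳ i) < (x ⟨$⟩ʳ j) × y ≈ swapAt i j x

_≤ʷ_ : Rel (Permutation′ n) 0ℓ
_≤ʷ_ = Star (_≈_ ∪ _⋖_)

infix 4 _⟶_

-- y ⟶ x : x is obtained from y by a (3412 → 3142)-move.
_⟶_ : Rel (Permutation′ n) 0ℓ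
y ⟶ x = ∃₂ λ q r → Occ3-41-2 y q r × x ≈ swapAt q r y

-- The lattice congruence contracting exactly the covers x ⋖ y with y ⟶ x; its
-- classes are intervals, so it is the equivalence generated by the moves.
Θ₃₄₁₂ : Rel (Permutation′ n) 0ℓ
Θ₃₄₁₂ = EqClosure (_≈_ ∪ _⟶_)

Class : Permutation′ n → Pred (Permutation′ n) 0ℓ
Class x y = Θ₃₄₁₂ x y

IsMinimumOf : Pred (Permutation′ n) 0ℓ → Pred (Permutation′ n) 0ℓ
IsMinimumOf C m = m ∈ C × (∀ y → y ∈ C → m ≤ʷ y)

IsMaximumOf : Pred (Permutation′ n) 0ℓ → Pred (Permutation′ n) 0ℓ
IsMaximumOf C m = m ∈ C × (∀ y → y ∈ C → y ≤ʷ m)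

-- Every class has a minimum and a maximum: moves, in either direction, are
-- terminating and locally confluent, so following them from any element of a
-- class ends in one and the same permutation.

transpose-l : (i j : Fin n) → PC.transpose i j i ≡ j
transpose-l i j with i ≟ i
... | yes _  = refl
... | no i≢i = contradiction refl i≢i

transpose-r : (i j : Fin n) → PC.transpose i j j ≡ i
transpose-r i j with j ≟ i
... | yes j≡i = j≡i
... | no  _ with j ≟ j
...   | yes _  = refl
...   | no j≢j = contradiction refl j≢j

transpose-≢ : (i j : Fin n) {k : Fin n} → k ≢ i → k ≢ j →
              PC.transpose i j k ≡ k
transpose-≢ i j {k} k≢i k≢j with k ≟ i
... | yes k≡i = contradiction k≡i k≢i
... | no  _ with k ≟ j
...   | yes k≡j = contradiction k≡j k≢j
...   | no  _   = refl

transpose-invol : (i j k : Fin n) →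
                  PC.transpose i j (PC.transpose i j k) ≡ k
transpose-invol i j k with k ≟ i
... | yes refl = transpose-r k j
... | no k≢i with k ≟ j
...   | yes refl = transpose-l i k
...   | no k≢j   = transpose-≢ i j k≢i k≢j

<⇒≢ : {i j : Fin n} → i < j → i ≢ j
<⇒≢ i<i refl = ℕₚ.<-irrefl refl i<i

>⇒≢ : {i j : Fin n} → j < i → i ≢ j
>⇒≢ i<i refl = ℕₚ.<-irrefl refl i<i

next⇒< : {i j : Fin n} → Next i j → i < j
next⇒< {i = i} e = subst (toℕ i ℕ.<_) (sym e) (ℕₚ.n<1+n _)

-- Transpositions of adjacent positions commute when far apart and satisfy
-- the braid relation when they overlap.

transpose-comm : {q r q′ r′ : Fin n} → q < r → r < q′ → q′ < r′ → ∀ k →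
  PC.transpose q r (PC.transpose q′ r′ k) ≡
  PC.transpose q′ r′ (PC.transpose q r k)
transpose-comm {q = q} {r} {q′} {r′} q<r r<q′ q′<r′ k = go (k ≟ q) (k ≟ r)
  where
  t  = PC.transpose q r
  t′ = PC.transpose q′ r′
  q<q′ : q < q′
  q<q′ = ℕₚ.<-trans q<r r<q′
  r<r′ : r < r′
  r<r′ = ℕₚ.<-trans r<q′ q′<r′
  q<r′ : q < r′
  q<r′ = ℕₚ.<-trans q<q′ q′<r′
  t′q = transpose-≢ q′ r′ (<⇒≢ q<q′) (<⇒≢ q<r′)
  t′r = transpose-≢ q′ r′ (<⇒≢ r<q′) (<⇒≢ r<r′)
  tq′ = transpose-≢ q r (>⇒≢ q<q′) (>⇒≢ r<q′)
  tr′ = transpose-≢ q r (>⇒≢ q<r′) (>⇒≢ r<r′)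
  go₂ : k ≢ q → k ≢ r → Dec (k ≡ q′) → Dec (k ≡ r′) → t (t′ k) ≡ t′ (t k)
  go₂ a b (yes refl) _ =
    trans (cong t (transpose-l q′ r′))
      (trans tr′ (sym (trans (cong t′ tq′) (transpose-l q′ r′))))
  go₂ a b (no _) (yes refl) =
    trans (cong t (transpose-r q′ r′))
      (trans tq′ (sym (trans (cong t′ tr′) (transpose-r q′ r′))))
  go₂ a b (no c) (no d) =
    trans (cong t (transpose-≢ q′ r′ c d))
      (trans (transpose-≢ q r a b)
        (sym (trans (cong t′ (transpose-≢ q r a b))
          (transpose-≢ q′ r′ c d))))
  go : Dec (k ≡ q) → Dec (k ≡ r) → t (t′ k) ≡ t′ (t k)
  go (yes refl) _ =
    trans (cong t t′q) (trans (transpose-l q r)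
      (sym (trans (cong t′ (transpose-l q r)) t′r)))
  go (no _) (yes refl) =
    trans (cong t t′r) (trans (transpose-r q r)
      (sym (trans (cong t′ (transpose-r q r)) t′q)))
  go (no a) (no b) = go₂ a b (k ≟ q′) (k ≟ r′)

transpose-braid : {q r s : Fin n} → q < r → r < s → ∀ k →
  PC.transpose q r (PC.transpose r s (PC.transpose q r k)) ≡
  PC.transpose r s (PC.transpose q r (PC.transpose r s k))
transpose-braid {q = q} {r} {s} q<r r<s k = go (k ≟ q) (k ≟ r) (k ≟ s)
  where
  t  = PC.transpose q r
  t′ = PC.transpose r s
  q<s : q < s
  q<s = ℕₚ.<-trans q<r r<s
  ts  = transpose-≢ q r (>⇒≢ q<s) (>⇒≢ r<s)
  t′q = transpose-≢ r s (<⇒≢ q<r) (<⇒≢ q<s)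
  tq  = transpose-l q r
  tr  = transpose-r q r
  t′r = transpose-l r s
  t′s = transpose-r r s
  go : Dec (k ≡ q) → Dec (k ≡ r) → Dec (k ≡ s) → t (t′ (t k)) ≡ t′ (t (t′ k))
  go (yes refl) _ _ =
    trans (cong (t ∘ t′) tq) (trans (cong t t′r) (trans ts
      (sym (trans (cong (t′ ∘ t) t′q) (trans (cong t′ tq) t′r)))))
  go (no _) (yes refl) _ =
    trans (cong (t ∘ t′) tr) (trans (cong t t′q) (trans tq
      (sym (trans (cong (t′ ∘ t) t′r) (trans (cong t′ ts) t′s)))))
  go (no _) (no _) (yes refl) =
    trans (cong (t ∘ t′) ts) (trans (cong t t′s) (trans tr
      (sym (trans (cong (t′ ∘ t) t′s) (trans (cong t′ tr) t′q)))))
  go (no a) (no b) (no c) =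
    trans (cong (t ∘ t′) t₁) (trans (cong t t₂) (trans t₁
      (sym (trans (cong (t′ ∘ t) t₂) (trans (cong t′ t₁) t₂)))))
    where
    t₁ = transpose-≢ q r a b
    t₂ = transpose-≢ r s b c

-- Exchanging an adjacent descent lowers the sum of all prefix sums.

weight : {m : ℕ} → (Fin m → ℕ) → ℕ
weight {zero}  f = 0
weight {suc m} f = suc m * f zero + weight (f ∘ suc)

weight-cong : {m : ℕ} (f g : Fin m → ℕ) → (∀ k → g k ≡ f k) →
              weight g ≡ weight f
weight-cong {zero}  f g e = refl
weight-cong {suc m} f g e
  rewrite e zero | weight-cong (f ∘ suc) (g ∘ suc) (e ∘ suc) = refl

weight-swap : {m : ℕ} (f g : Fin m → ℕ) (q r : Fin m) → Next q r →
  g q ≡ f r → g r ≡ f q → (∀ k → k ≢ q → k ≢ r → g k ≡ f k) →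
  f r ℕ.< f q → weight g ℕ.< weight f
weight-swap f g zero zero () gq gr other lt
weight-swap {suc (suc m)} f g zero (suc zero) e gq gr other lt
  rewrite gq | gr
        | weight-cong (λ k → f (suc (suc k))) (λ k → g (suc (suc k)))
            (λ k → other (suc (suc k)) (λ ()) (λ ()))
  = subst₂ ℕ._<_ (sym (lhs m (f (suc zero)) (f zero) w))
      (sym (rhs m (f (suc zero)) (f zero) w))
      (ℕₚ.+-monoˡ-< (suc m * f (suc zero) + (suc m * f zero + w)) lt)
  where
  w = weight (λ k → f (suc (suc k)))
  lhs : ∀ m a d w → suc (suc m) * a + (suc m * d + w) ≡
                    a + (suc m * a + (suc m * d + w))
  lhs = solve-∀
  rhs : ∀ m a d w → suc (suc m) * d + (suc m * a + w) ≡
                    d + (suc m * a + (suc m * d + w))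
  rhs = solve-∀
weight-swap f g zero (suc (suc r)) () gq gr other lt
weight-swap f g (suc q) zero () gq gr other lt
weight-swap {suc m} f g (suc q) (suc r) e gq gr other lt
  rewrite other zero (λ ()) (λ ()) =
    ℕₚ.+-monoʳ-< (suc m * f zero)
      (weight-swap (f ∘ suc) (g ∘ suc) q r (ℕₚ.suc-injective e) gq gr
        (λ k k≢q k≢r → other (suc k) (k≢q ∘ sucInj) (k≢r ∘ sucInj)) lt)
  where
  sucInj : ∀ {m} {i j : Fin m} → Fin.suc i ≡ suc j → i ≡ j
  sucInj refl = refl

-- Both directions of the moves at once: with ρ = toℕ a redex is an occurrence
-- of 3-41-2, with ρ reversing the order it is an occurrence of 3-14-2.
module Moves {n : ℕ} (ρ : Fin n → ℕ) where

  infix 4 _≺_ _⇝_ _↠_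

  _≺_ : Rel (Fin n) 0ℓ
  u ≺ v = ρ u ℕ.< ρ v

  Redex : Permutation′ n → Fin n → Fin n → Set
  Redex x q r = Next q r × ∃₂ λ p s → p < q × r < s ×
    (x ⟨$⟩ʳ r) ≺ (x ⟨$⟩ʳ p) × (x ⟨$⟩ʳ p) ≺ (x ⟨$⟩ʳ q) ×
    (x ⟨$⟩ʳ r) ≺ (x ⟨$⟩ʳ s) × (x ⟨$⟩ʳ s) ≺ (x ⟨$⟩ʳ q) ×
    (x ⟨$⟩ʳ s) < (x ⟨$⟩ʳ p)

  _⇝_ : Rel (Permutation′ n) 0ℓ
  y ⇝ x = ∃₂ λ q r → Redex y q r × x ≈ swapAt q r y

  _↠_ : Rel (Permutation′ n) 0ℓ
  _↠_ = Star (_≈_ ∪ _⇝_)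

  redex? : ∀ x q r → Dec (Redex x q r)
  redex? x q r = (toℕ r ℕₚ.≟ suc (toℕ q)) ×-dec
    any? (λ p → any? (λ s → (p <? q) ×-dec (r <? s) ×-dec
      (_ ℕₚ.<? _) ×-dec (_ ℕₚ.<? _) ×-dec (_ ℕₚ.<? _) ×-dec (_ ℕₚ.<? _)
      ×-dec (_ <? _)))

  mkRedex : ∀ (x : Permutation′ n) {q r} p s {d a c b} →
    Next q r → p < q → r < s →
    x ⟨$⟩ʳ q ≡ d → x ⟨$⟩ʳ r ≡ a → x ⟨$⟩ʳ p ≡ c → x ⟨$⟩ʳ s ≡ b →
    a ≺ c → c ≺ d → a ≺ b → b ≺ d → b < c → Redex x q r
  mkRedex x p s nx p<q r<s refl refl refl refl ac cd ab bd bc =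
    nx , p , s , p<q , r<s , ac , cd , ab , bd , bc

  contract : ∀ x {q r} → Redex x q r → x ↠ swapAt q r x
  contract x rx = inj₂ (_ , _ , rx , λ _ → refl) ◅ ε

  ≈⇒↠ : ∀ x y → x ≈ y → x ↠ y
  ≈⇒↠ x y e = inj₁ e ◅ ε

  size : Permutation′ n → ℕ
  size x = weight (λ i → ρ (x ⟨$⟩ʳ i))

  size-swap : ∀ x {q r} → Redex x q r → size (swapAt q r x) ℕ.< size x
  size-swap x {q} {r} (nx , p , s , _ , _ , ac , cd , _) =
    weight-swap (λ i → ρ (x ⟨$⟩ʳ i)) (λ i → ρ (swapAt q r x ⟨$⟩ʳ i)) q r nx
      (cong (λ i → ρ (x ⟨$⟩ʳ i)) (transpose-l q r))
      (cong (λ i → ρ (x ⟨$⟩ʳ i)) (transpose-r q r))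
      (λ k k≢q k≢r → cong (λ i → ρ (x ⟨$⟩ʳ i)) (transpose-≢ q r k≢q k≢r))
      (ℕₚ.<-trans ac cd)

  Joinable : Rel (Permutation′ n) 0ℓ
  Joinable y z = ∃ λ w → y ↠ w × z ↠ w

  join-sym : ∀ {y z} → Joinable y z → Joinable z y
  join-sym (w , y↠w , z↠w) = w , z↠w , y↠w

  join-far : ∀ x {q r q′ r′} → Redex x q r → Redex x q′ r′ → r < q′ →
             Joinable (swapAt q r x) (swapAt q′ r′ x)
  join-far x {q} {r} {q′} {r′}
    (nx , p , s , p<q , r<s , ac , cd , ab , bd , bc)
    (nx′ , p′ , s′ , p′<q′ , r′<s′ , ac′ , cd′ , ab′ , bd′ , bc′) r<q′ =
    swapAt q′ r′ (swapAt q r x) ,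
    contract (swapAt q r x) redex₁ ,
    contract (swapAt q′ r′ x) redex₂ ◅◅
    ≈⇒↠ (swapAt q r (swapAt q′ r′ x)) (swapAt q′ r′ (swapAt q r x))
      (λ k → at (sym (transpose-comm q<r r<q′ q′<r′ k)))
    where
    q<r : q < r
    q<r = next⇒< nx
    q′<r′ : q′ < r′
    q′<r′ = next⇒< nx′
    q<q′ : q < q′
    q<q′ = ℕₚ.<-trans q<r r<q′
    r<r′ : r < r′
    r<r′ = ℕₚ.<-trans r<q′ q′<r′
    q<r′ : q < r′
    q<r′ = ℕₚ.<-trans q<q′ q′<r′
    at : ∀ {i j} → i ≡ j → x ⟨$⟩ʳ i ≡ x ⟨$⟩ʳ j
    at = cong (x ⟨$⟩ʳ_)

    left : ∀ k → k < q′ → PC.transpose q r k < q′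
    left k k<q′ with k ≟ q
    ... | yes _ = r<q′
    ... | no _ with k ≟ r
    ...   | yes _ = q<q′
    ...   | no _  = k<q′

    right : ∀ k → r < k → r < PC.transpose q′ r′ k
    right k r<k with k ≟ q′
    ... | yes _ = r<r′
    ... | no _ with k ≟ r′
    ...   | yes _ = r<q′
    ...   | no _  = r<k

    redex₁ : Redex (swapAt q r x) q′ r′
    redex₁ = mkRedex (swapAt q r x) (PC.transpose q r p′) s′ nx′
      (left p′ p′<q′) r′<s′
      (at (transpose-≢ q r (>⇒≢ q<q′) (>⇒≢ r<q′)))
      (at (transpose-≢ q r (>⇒≢ q<r′) (>⇒≢ r<r′)))
      (at (transpose-invol q r p′))
      (at (transpose-≢ q r (>⇒≢ (ℕₚ.<-trans q<r′ r′<s′))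
                           (>⇒≢ (ℕₚ.<-trans r<r′ r′<s′))))
      ac′ cd′ ab′ bd′ bc′

    redex₂ : Redex (swapAt q′ r′ x) q r
    redex₂ = mkRedex (swapAt q′ r′ x) p (PC.transpose q′ r′ s) nx
      p<q (right s r<s)
      (at (transpose-≢ q′ r′ (<⇒≢ q<q′) (<⇒≢ q<r′)))
      (at (transpose-≢ q′ r′ (<⇒≢ r<q′) (<⇒≢ r<r′)))
      (at (transpose-≢ q′ r′ (<⇒≢ (ℕₚ.<-trans p<q q<q′))
                             (<⇒≢ (ℕₚ.<-trans p<q q<r′))))
      (at (transpose-invol q′ r′ s))
      ac cd ab bd bc

  -- The entries d, a, e in positions q, r, t satisfy e ≺ a ≺ d.
  join-near : ∀ x {q r t} → Redex x q r → Redex x r t →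
              Joinable (swapAt q r x) (swapAt r t x)
  join-near x {q} {r} {t}
    (nx , p , s , p<q , r<s , ac , cd , ab , bd , bc)
    (nx′ , p′ , s′ , p′<r , t<s′ , ec′ , ca′ , eb′ , ba′ , bc′) =
    swapAt q r (swapAt r t (swapAt q r x)) ,
    contract (swapAt q r x) redex₁ ◅◅
    contract (swapAt r t (swapAt q r x)) redex₁′ ,
    contract (swapAt r t x) redex₂ ◅◅
    contract (swapAt q r (swapAt r t x)) redex₂′ ◅◅
    ≈⇒↠ (swapAt r t (swapAt q r (swapAt r t x)))
        (swapAt q r (swapAt r t (swapAt q r x)))
        (λ k → at (sym (transpose-braid q<r r<t k)))
    where
    q<r : q < r
    q<r = next⇒< nx
    r<t : r < t
    r<t = next⇒< nx′
    q<t : q < t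
    q<t = ℕₚ.<-trans q<r r<t
    at : ∀ {i j} → i ≡ j → x ⟨$⟩ʳ i ≡ x ⟨$⟩ʳ j
    at = cong (x ⟨$⟩ʳ_)
    τ  = PC.transpose q r
    τ′ = PC.transpose r t

    a≺d : (x ⟨$⟩ʳ r) ≺ (x ⟨$⟩ʳ q)
    a≺d = ℕₚ.<-trans ac cd
    e≺a : (x ⟨$⟩ʳ t) ≺ (x ⟨$⟩ʳ r)
    e≺a = ℕₚ.<-trans ec′ ca′

    p′<q : p′ < q
    p′<q = ℕₚ.≤∧≢⇒< (ℕₚ.≤-pred (subst (suc (toℕ p′) ℕ.≤_) nx p′<r))
      (λ e → ℕₚ.<-asym {ρ (x ⟨$⟩ʳ r)} a≺d
        (subst (λ i → (x ⟨$⟩ʳ i) ≺ (x ⟨$⟩ʳ r)) (toℕ-injective e) ca′))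

    t<s : t < s
    t<s = ℕₚ.≤∧≢⇒< (subst (ℕ._≤ toℕ s) (sym nx′) r<s)
      (λ e → ℕₚ.<-asym {ρ (x ⟨$⟩ʳ t)} e≺a
        (subst (λ i → (x ⟨$⟩ʳ r) ≺ (x ⟨$⟩ʳ i)) (sym (toℕ-injective e)) ab))

    τ-left : ∀ {k} → k < q → τ k ≡ k
    τ-left k<q = transpose-≢ q r (<⇒≢ k<q) (<⇒≢ (ℕₚ.<-trans k<q q<r))
    τ-right : ∀ {k} → t < k → τ k ≡ k
    τ-right t<k = transpose-≢ q r (>⇒≢ (ℕₚ.<-trans q<t t<k))
                                  (>⇒≢ (ℕₚ.<-trans r<t t<k))
    τ′-left : ∀ {k} → k < q → τ′ k ≡ k
    τ′-left k<q = transpose-≢ r t (<⇒≢ (ℕₚ.<-trans k<q q<r))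
                                  (<⇒≢ (ℕₚ.<-trans k<q q<t))
    τ′-right : ∀ {k} → t < k → τ′ k ≡ k
    τ′-right t<k = transpose-≢ r t (>⇒≢ (ℕₚ.<-trans r<t t<k)) (>⇒≢ t<k)
    τq  = transpose-l q r
    τr  = transpose-r q r
    τt  = transpose-≢ q r (>⇒≢ q<t) (>⇒≢ r<t)
    τ′q = transpose-≢ r t (<⇒≢ q<r) (<⇒≢ q<t)
    τ′r = transpose-l r t
    τ′t = transpose-r r t

    redex₁ : Redex (swapAt q r x) r t
    redex₁ = mkRedex (swapAt q r x) p′ s′ nx′ p′<r t<s′
      (at τr) (at τt) (at (τ-left p′<q)) (at (τ-right t<s′))
      ec′ (ℕₚ.<-trans ca′ a≺d) eb′ (ℕₚ.<-trans ba′ a≺d) bc′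

    redex₁′ : Redex (swapAt r t (swapAt q r x)) q r
    redex₁′ = mkRedex (swapAt r t (swapAt q r x)) p′ s′ nx p′<q
      (ℕₚ.<-trans r<t t<s′)
      (at (trans (cong τ τ′q) τq)) (at (trans (cong τ τ′r) τt))
      (at (trans (cong τ (τ′-left p′<q)) (τ-left p′<q)))
      (at (trans (cong τ (τ′-right t<s′)) (τ-right t<s′)))
      ec′ ca′ eb′ ba′ bc′

    redex₂ : Redex (swapAt r t x) q r
    redex₂ = mkRedex (swapAt r t x) p′ s′ nx p′<q (ℕₚ.<-trans r<t t<s′)
      (at τ′q) (at τ′r) (at (τ′-left p′<q)) (at (τ′-right t<s′))
      ec′ (ℕₚ.<-trans ca′ a≺d) eb′ (ℕₚ.<-trans ba′ a≺d) bc′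

    redex₂′ : Redex (swapAt q r (swapAt r t x)) r t
    redex₂′ = mkRedex (swapAt q r (swapAt r t x)) p s nx′
      (ℕₚ.<-trans p<q q<r) t<s
      (at (trans (cong τ′ τr) τ′q)) (at (trans (cong τ′ τt) τ′t))
      (at (trans (cong τ′ (τ-left p<q)) (τ′-left p<q)))
      (at (trans (cong τ′ (τ-right t<s)) (τ′-right t<s)))
      ac cd ab bd bc

  next-unique : {i j k : Fin n} → Next i j → Next i k → j ≡ k
  next-unique e e′ = toℕ-injective (trans e (sym e′))

  join-< : ∀ x {q r q′ r′} → Redex x q r → Redex x q′ r′ → q < q′ →
           Joinable (swapAt q r x) (swapAt q′ r′ x)
  join-< x {q} {r} {q′} rx rx′ q<q′ with r ≟ q′
  ... | yes refl = join-near x rx rx′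
  ... | no r≢q′  = join-far x rx rx′
        (ℕₚ.≤∧≢⇒< (subst (ℕ._≤ toℕ q′) (sym (proj₁ rx)) q<q′)
          (r≢q′ ∘ toℕ-injective))

  join : ∀ x {q r q′ r′} → Redex x q r → Redex x q′ r′ →
         Joinable (swapAt q r x) (swapAt q′ r′ x)
  join x {q} {r} {q′} rx rx′ with ℕₚ.<-cmp (toℕ q) (toℕ q′)
  ... | tri< q<q′ _ _ = join-< x rx rx′ q<q′
  ... | tri> _ _ q′<q = join-sym (join-< x rx′ rx q′<q)
  ... | tri≈ _ e _ with toℕ-injective e
  ...   | refl with next-unique (proj₁ rx) (proj₁ rx′)
  ...     | refl = swapAt q r x , ε , ε

  record NormalForm (x : Permutation′ n) : Set where
    field
      nf      : Permutation′ n
      normal  : ∀ q r → ¬ Redex nf q r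
      reaches : x ↠ nf
      unique  : ∀ z → x ↠ z → z ↠ nf
  open NormalForm

  ≈-redex : ∀ x y {q r} → x ≈ y → Redex y q r → Redex x q r
  ≈-redex x y e (nx , p , s , p<q , r<s , ac , cd , ab , bd , bc) =
    mkRedex x p s nx p<q r<s (e _) (e _) (e _) (e _) ac cd ab bd bc

  normal-↠ : ∀ x z → (∀ q r → ¬ Redex x q r) → x ↠ z → x ≈ z
  normal-↠ x z nm ε = λ _ → refl
  normal-↠ x z nm (_◅_ {j = y} (inj₁ x≈y) y↠z) k = trans (x≈y k)
    (normal-↠ y z (λ q r ry → nm q r (≈-redex x y x≈y ry)) y↠z k)
  normal-↠ x z nm (inj₂ (q , r , rx , _) ◅ _) = contradiction rx (nm q r)

  -- A reduction does nothing, or it begins with the contraction of a redex.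
  step : ∀ x z → x ↠ z → x ≈ z ⊎ (∃₂ λ q r → Redex x q r × swapAt q r x ↠ z)
  step x z ε = inj₁ (λ _ → refl)
  step x z (_◅_ {j = y} (inj₂ (q , r , rx , e)) y↠z) =
    inj₂ (q , r , rx , ≈⇒↠ (swapAt q r x) y (λ k → sym (e k)) ◅◅ y↠z)
  step x z (_◅_ {j = y} (inj₁ x≈y) y↠z) with step y z y↠z
  ... | inj₁ y≈z = inj₁ (λ k → trans (x≈y k) (y≈z k))
  ... | inj₂ (q , r , ry , s↠z) =
        inj₂ (q , r , ≈-redex x y x≈y ry ,
          ≈⇒↠ (swapAt q r x) (swapAt q r y) (λ k → x≈y _) ◅◅ s↠z)

  normalise : ∀ x → Acc ℕ._<_ (size x) → NormalForm x
  normalise x (acc rec) with any? (λ q → any? (λ r → redex? x q r))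
  ... | no none = record
    { nf      = x
    ; normal  = λ q r rx → none (q , r , rx)
    ; reaches = ε
    ; unique  = λ z x↠z → ≈⇒↠ z x
        (λ k → sym (normal-↠ x z (λ q r rx → none (q , r , rx)) x↠z k))
    }
  ... | yes (q , r , rx) = record
    { nf      = nf N
    ; normal  = normal N
    ; reaches = contract x rx ◅◅ reaches N
    ; unique  = uniq
    }
    where
    N = normalise (swapAt q r x) (rec (size-swap x rx))
    uniq : ∀ z → x ↠ z → z ↠ nf N
    uniq z x↠z with step x z x↠z
    ... | inj₁ x≈z = ≈⇒↠ z x (λ k → sym (x≈z k)) ◅◅ (contract x rx ◅◅ reaches N)
    ... | inj₂ (q′ , r′ , rx′ , y↠z) with join x rx rx′
    ...   | w , N↠w , N′↠w =
      unique N′ z y↠z ◅◅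
      ≈⇒↠ (nf N′) (nf N) (λ k → sym (normal-↠ (nf N) (nf N′) (normal N)
        (unique N′ (nf N) (N′↠w ◅◅ unique N w N↠w)) k))
      where
      N′ = normalise (swapAt q′ r′ x) (rec (size-swap x rx′))

  normalForm : ∀ x → NormalForm x
  normalForm x = normalise x (<-wellFounded (size x))

  nf-↠ : ∀ x y → x ↠ y → nf (normalForm x) ≈ nf (normalForm y)
  nf-↠ x y x↠y k = sym (normal-↠ (nf Y) (nf X) (normal Y)
    (unique X (nf Y) (x↠y ◅◅ reaches Y)) k)
    where
    X = normalForm x
    Y = normalForm y

  nf-Eq : ∀ x y → EqClosure (_≈_ ∪ _⇝_) x y →
          nf (normalForm x) ≈ nf (normalForm y)
  nf-Eq x y ε = λ _ → refl
  nf-Eq x y (_◅_ {j = z} (fwd g) gs) k =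
    trans (nf-↠ x z (g ◅ ε) k) (nf-Eq z y gs k)
  nf-Eq x y (_◅_ {j = z} (bwd g) gs) k =
    trans (sym (nf-↠ z x (g ◅ ε) k)) (nf-Eq z y gs k)

  extremum : ∀ x → ∃ λ m → x ↠ m ×
               (∀ y → EqClosure (_≈_ ∪ _⇝_) x y → y ↠ m)
  extremum x = nf (normalForm x) , reaches (normalForm x) ,
    λ y x~y → reaches (normalForm y) ◅◅
      ≈⇒↠ (nf (normalForm y)) (nf (normalForm x))
        (λ k → sym (nf-Eq x y x~y k))

module Down {n : ℕ} = Moves {n} toℕ
module Up   {n : ℕ} = Moves {n} (λ u → n ∸ toℕ u)

rev-< : {u v : Fin n} → u < v → n ∸ toℕ v ℕ.< n ∸ toℕ u
rev-< {v = v} u<v = ℕₚ.∸-monoʳ-< u<v (ℕₚ.<⇒≤ (toℕ<n v))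

unrev-< : {u v : Fin n} → n ∸ toℕ v ℕ.< n ∸ toℕ u → u < v
unrev-< {n} {u} {v} lt = ℕₚ.≰⇒>
  (λ v≤u → ℕₚ.<⇒≱ lt (ℕₚ.∸-monoʳ-≤ n v≤u))

module Unswap (x y : Permutation′ n) {q r : Fin n}
              (e : x ≈ swapAt q r y) where

  unswap : y ≈ swapAt q r x
  unswap k = sym (trans (e _) (cong (y ⟨$⟩ʳ_) (transpose-invol q r k)))

  at-l : x ⟨$⟩ʳ q ≡ y ⟨$⟩ʳ r
  at-l = trans (e q) (cong (y ⟨$⟩ʳ_) (transpose-l q r))

  at-r : x ⟨$⟩ʳ r ≡ y ⟨$⟩ʳ q
  at-r = trans (e r) (cong (y ⟨$⟩ʳ_) (transpose-r q r))

  before : ∀ {k} → q < r → k < q → x ⟨$⟩ʳ k ≡ y ⟨$⟩ʳ k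
  before q<r k<q = trans (e _) (cong (y ⟨$⟩ʳ_)
    (transpose-≢ q r (<⇒≢ k<q) (<⇒≢ (ℕₚ.<-trans k<q q<r))))

  after : ∀ {k} → q < r → r < k → x ⟨$⟩ʳ k ≡ y ⟨$⟩ʳ k
  after q<r r<k = trans (e _) (cong (y ⟨$⟩ʳ_)
    (transpose-≢ q r (>⇒≢ (ℕₚ.<-trans q<r r<k)) (>⇒≢ r<k)))

⟶⇒down : (y x : Permutation′ n) → y ⟶ x → y Down.⇝ x
⟶⇒down y x (q , r , (nx , p , s , p<q , r<s , ab , bc , cd) , e) =
  q , r , (nx , p , s , p<q , r<s , ℕₚ.<-trans ab bc , cd , ab ,
           ℕₚ.<-trans bc cd , bc) , e

down⇒⟶ : (y x : Permutation′ n) → y Down.⇝ x → y ⟶ x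
down⇒⟶ y x (q , r , (nx , p , s , p<q , r<s , _ , cd , ab , _ , bc) , e) =
  q , r , (nx , p , s , p<q , r<s , ab , bc , cd) , e

down⇒⋖ : (y x : Permutation′ n) → y Down.⇝ x → x ⋖ y
down⇒⋖ y x (q , r , (nx , _ , _ , _ , _ , ac , cd , _) , e) =
  q , r , nx , subst₂ _<_ (sym at-l) (sym at-r) (ℕₚ.<-trans ac cd) , unswap
  where
  open Unswap x y e

⟶⇒up : (y x : Permutation′ n) → y ⟶ x → x Up.⇝ y
⟶⇒up y x (q , r , (nx , p , s , p<q , r<s , ab , bc , cd) , e) =
  q , r ,
  Up.mkRedex x p s nx p<q r<s
    at-l at-r (before (next⇒< nx) p<q) (after (next⇒< nx) r<s)
    (rev-< cd) (rev-< (ℕₚ.<-trans ab bc)) (rev-< (ℕₚ.<-trans bc cd))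
    (rev-< ab) bc ,
  unswap
  where
  open Unswap x y e

up⇒⟶ : (x y : Permutation′ n) → x Up.⇝ y → y ⟶ x
up⇒⟶ x y (q , r , (nx , p , s , p<q , r<s , dc , ca , db , ba , bc) , e) =
  q , r ,
  (nx , p , s , p<q , r<s ,
    subst₂ _<_ (sym at-r) (sym eqs) (unrev-< ba) ,
    subst₂ _<_ (sym eqs) (sym eqp) bc ,
    subst₂ _<_ (sym eqp) (sym at-l) (unrev-< dc)) ,
  unswap
  where
  open Unswap y x e
  eqp = before (next⇒< nx) p<q
  eqs = after (next⇒< nx) r<s

up⇒⋖ : (x y : Permutation′ n) → x Up.⇝ y → x ⋖ y
up⇒⋖ x y (q , r , (nx , p , _ , _ , _ , dc , ca , _) , e) =
  q , r , nx ,
  ℕₚ.<-trans (unrev-< {v = x ⟨$⟩ʳ p} ca) (unrev-< {u = x ⟨$⟩ʳ p} dc) , e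

↠⇒≥ʷ : (y x : Permutation′ n) → y Down.↠ x → x ≤ʷ y
↠⇒≥ʷ y x ε = ε
↠⇒≥ʷ y x (_◅_ {j = z} (inj₁ e) gs) =
  ↠⇒≥ʷ z x gs ◅◅ (inj₁ (λ k → sym (e k)) ◅ ε)
↠⇒≥ʷ y x (_◅_ {j = z} (inj₂ g) gs) =
  ↠⇒≥ʷ z x gs ◅◅ (inj₂ (down⇒⋖ y z g) ◅ ε)

↠⇒≤ʷ : (x y : Permutation′ n) → x Up.↠ y → x ≤ʷ y
↠⇒≤ʷ x y ε = ε
↠⇒≤ʷ x y (_◅_ {j = z} (inj₁ e) gs) = inj₁ e ◅ ↠⇒≤ʷ z y gs
↠⇒≤ʷ x y (_◅_ {j = z} (inj₂ g) gs) = inj₂ (up⇒⋖ x z g) ◅ ↠⇒≤ʷ z y gs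

down⇒Θ : (x y : Permutation′ n) → x Down.↠ y → Θ₃₄₁₂ x y
down⇒Θ x y ε = ε
down⇒Θ x y (_◅_ {j = z} (inj₁ e) gs) = fwd (inj₁ e) ◅ down⇒Θ z y gs
down⇒Θ x y (_◅_ {j = z} (inj₂ g) gs) = fwd (inj₂ (down⇒⟶ x z g)) ◅ down⇒Θ z y gs

up⇒Θ : (x y : Permutation′ n) → x Up.↠ y → Θ₃₄₁₂ x y
up⇒Θ x y ε = ε
up⇒Θ x y (_◅_ {j = z} (inj₁ e) gs) = fwd (inj₁ e) ◅ up⇒Θ z y gs
up⇒Θ x y (_◅_ {j = z} (inj₂ g) gs) = bwd (inj₂ (up⇒⟶ x z g)) ◅ up⇒Θ z y gs

Θ⇒down : (x y : Permutation′ n) → Θ₃₄₁₂ x y →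
         EqClosure (_≈_ ∪ Down._⇝_) x y
Θ⇒down x y ε = ε
Θ⇒down x y (_◅_ {j = z} (fwd (inj₁ e)) gs) = fwd (inj₁ e) ◅ Θ⇒down z y gs
Θ⇒down x y (_◅_ {j = z} (fwd (inj₂ g)) gs) =
  fwd (inj₂ (⟶⇒down x z g)) ◅ Θ⇒down z y gs
Θ⇒down x y (_◅_ {j = z} (bwd (inj₁ e)) gs) = bwd (inj₁ e) ◅ Θ⇒down z y gs
Θ⇒down x y (_◅_ {j = z} (bwd (inj₂ g)) gs) =
  bwd (inj₂ (⟶⇒down z x g)) ◅ Θ⇒down z y gs

Θ⇒up : (x y : Permutation′ n) → Θ₃₄₁₂ x y → EqClosure (_≈_ ∪ Up._⇝_) x y
Θ⇒up x y ε = ε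
Θ⇒up x y (_◅_ {j = z} (fwd (inj₁ e)) gs) = fwd (inj₁ e) ◅ Θ⇒up z y gs
Θ⇒up x y (_◅_ {j = z} (fwd (inj₂ g)) gs) =
  bwd (inj₂ (⟶⇒up x z g)) ◅ Θ⇒up z y gs
Θ⇒up x y (_◅_ {j = z} (bwd (inj₁ e)) gs) = bwd (inj₁ e) ◅ Θ⇒up z y gs
Θ⇒up x y (_◅_ {j = z} (bwd (inj₂ g)) gs) =
  fwd (inj₂ (⟶⇒up z x g)) ◅ Θ⇒up z y gs

class-minimum : (x : Permutation′ n) → ∃ (IsMinimumOf (Class x))
class-minimum x with Down.extremum x
... | m , x↠m , below = m , down⇒Θ x m x↠m ,
  λ y xΘy → ↠⇒≥ʷ y m (below y (Θ⇒down x y xΘy))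

class-maximum : (x : Permutation′ n) → ∃ (IsMaximumOf (Class x))
class-maximum x with Up.extremum x
... | m , x↠m , above = m , up⇒Θ x m x↠m ,
  λ y xΘy → ↠⇒≤ʷ y m (above y (Θ⇒up x y xΘy))

π↓ : Permutation′ n → Permutation′ n
π↓ x = proj₁ (class-minimum x)

π↑ : Permutation′ n → Permutation′ n
π↑ x = proj₁ (class-maximum x)

π↓-minimum : (x : Permutation′ n) → IsMinimumOf (Class x) (π↓ x)
π↓-minimum x = proj₂ (class-minimum x)

π↑-maximum : (x : Permutation′ n) → IsMaximumOf (Class x) (π↑ x)
π↑-maximum x = proj₂ (class-maximum x)

infix 4 _≋_

_≋_ : {P : Pred (Permutation′ n) 0ℓ} → Rel (Σ (Permutation′ n) P) 0ℓ
_≋_ = _≈_ on proj₁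

{-# OPTIONS --safe #-}
module Submission where

-- π↓ and π↑ compute normal forms of the two directions of the moves, so only
-- the avoidance of 2-41-3 has to be carried along a class; it is not invariant
-- under single moves (45213, 42513, 42153 is a class whose middle element alone
-- contains 2-41-3).  What is invariant is the following (Separated): d stands
-- before a, no entry between them in position is between them in value, and the
-- entries with values in (a, d) left of d are smaller than those right of a,
-- with both kinds present.  Such a configuration forces a 2-41-3, at the descent
-- from ≥ d to ≤ a.  Conversely, a 2-41-3 in a permutation avoiding 3-41-2 is one;
-- in a permutation avoiding 3-14-2 it becomes one after narrowing the interval
-- (a, d) as long as possible.

open import Data.Fin.Base using (Fin; toℕ; fromℕ<; _≤_; _<_)
open import Data.Fin.Induction using (<-wellFounded; >-wellFounded)
open import Data.Fin.Permutation
  using (Permutation′; _⟨$⟩ʳ_; _⟨$⟩ˡ_; _≈_; inverseˡ; inverseʳ)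
import Data.Fin.Permutation.Components as PC
open import Data.Fin.Properties
  using (toℕ-injective; toℕ-fromℕ<; toℕ<n; _≟_; _≤?_; _<?_; any?)
open import Data.Nat.Base as ℕ using (ℕ; suc; _∸_; _≥_)
import Data.Nat.Induction as ℕᵢ
import Data.Nat.Properties as ℕₚ
open import Data.Product.Base using (Σ-syntax; ∃; ∃₂; _×_; _,_; proj₁; proj₂; map)
open import Data.Sum.Base using (_⊎_; inj₁; inj₂)
open import Function.Bundles using (Injection)
open import Function.Properties.Inverse using (↔⇒↣)
open import Function.Structures using (IsBijection; IsCongruent; IsInverse)
open import Induction.WellFounded using (Acc; acc; WellFounded)
open import Level using (0ℓ)
open import Relation.Binary.Construct.Closure.Equivalence using (symmetric)
open import Relation.Binary.Construct.Closure.ReflexiveTransitive using (ε; _◅_; _◅◅_)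
open import Relation.Binary.Construct.Closure.Symmetric using (fwd; bwd)
import Relation.Binary.Construct.On as On
open import Relation.Binary.Core using (Rel)
open import Relation.Binary.Definitions as Binary using (tri<; tri≈; tri>)
open import Relation.Binary.PropositionalEquality
  using (_≡_; _≢_; refl; sym; trans; cong; subst; subst₂)
open import Relation.Binary.Structures using (IsEquivalence)
open import Relation.Nullary using (¬_; yes; no; contradiction)
open import Relation.Nullary.Decidable using (_×-dec_)
open import Relation.Unary using (Pred; Decidable)
open import Defs

private
  variable
    n : ℕ

-- Extremal witnesses and crossings in finite linear orders.

≢∧≮⇒> : {i j : Fin n} → i ≢ j → ¬ i < j → j < i
≢∧≮⇒> i≢j i≮j = ℕₚ.≤∧≢⇒< (ℕₚ.≮⇒≥ i≮j) (λ e → i≢j (sym (toℕ-injective e)))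

-- Reading `m ⊏ k` as an improvement of `m` on `k`, witnesses are improved until none is better. The
-- choice of relation gives a first or last position, or a greatest entry.
extremal : {_⊏_ : Rel (Fin n) 0ℓ} → WellFounded _⊏_ → Binary.Decidable _⊏_ →
           {P : Pred (Fin n) 0ℓ} → Decidable P → ∀ i → P i →
           ∃ λ k → P k × (∀ m → m ⊏ k → ¬ P m)
extremal {_⊏_ = _⊏_} wf _⊏?_ {P} P? i = go i (wf i)
  where
  go : ∀ i → Acc _⊏_ i → P i → ∃ λ k → P k × (∀ m → m ⊏ k → ¬ P m)
  go i (acc rec) pi with any? (λ m → (m ⊏? i) ×-dec P? m)
  ... | yes (m , m⊏i , pm) = go m (rec m⊏i) pm
  ... | no none            = i , pi , λ m m⊏i pm → none (m , m⊏i , pm)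

-- The last position from `i` up to but excluding `j` that satisfies `P` serves as `q`; its
-- successor fails `P`, by lastness or because it is `j`.
crossing : {P : Pred (Fin n) 0ℓ} → Decidable P → ∀ i j → i < j → P i → ¬ P j →
           ∃₂ λ q r → Next q r × i ≤ q × r ≤ j × P q × ¬ P r
crossing {n} {P} P? i j i<j pi ¬pj
  with extremal >-wellFounded (λ a b → b <? a)
         (λ k → (i ≤? k) ×-dec (k <? j) ×-dec P? k) i (ℕₚ.≤-refl , i<j , pi)
... | k , (i≤k , k<j , pk) , last = k , r , next , i≤k , r≤j , pk , ¬pr
  where
  k+1<n : suc (toℕ k) ℕ.< n
  k+1<n = ℕₚ.≤-<-trans k<j (toℕ<n j)
  r : Fin n
  r = fromℕ< k+1<n
  next : Next k r
  next = toℕ-fromℕ< k+1<n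
  r≤j : r ≤ j
  r≤j = subst (ℕ._≤ toℕ j) (sym next) k<j
  ¬pr : ¬ P r
  ¬pr pr = last r (next⇒< next)
    ( ℕₚ.≤-trans i≤k (ℕₚ.<⇒≤ (next⇒< next))
    , ℕₚ.≤∧≢⇒< r≤j (λ e → ¬pj (subst P (toℕ-injective e) pr))
    , pr)

-- Relative positions of values under an adjacent swap.

entry-≢ : (x : Permutation′ n) {i j : Fin n} → i ≢ j → x ⟨$⟩ʳ i ≢ x ⟨$⟩ʳ j
entry-≢ x i≢j e = i≢j (Injection.injective (↔⇒↣ x) e)

position-unique : (x : Permutation′ n) {i v : Fin n} → x ⟨$⟩ʳ i ≡ v → x ⟨$⟩ˡ v ≡ i
position-unique x refl = inverseˡ x

infix 4 _≺[_]_

-- Positions are compared through the values they carry, because an invariant of the moves has to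
-- name fixed values whose positions change.
_≺[_]_ : Fin n → Permutation′ n → Fin n → Set
u ≺[ x ] v = (x ⟨$⟩ˡ u) < (x ⟨$⟩ˡ v)

<⇒≺ : (x : Permutation′ n) {i j : Fin n} → i < j → (x ⟨$⟩ʳ i) ≺[ x ] (x ⟨$⟩ʳ j)
<⇒≺ x = subst₂ _<_ (sym (inverseˡ x)) (sym (inverseˡ x))

≺-resp-≈ : (x y : Permutation′ n) → x ≈ y → ∀ {u v} → u ≺[ x ] v → u ≺[ y ] v
≺-resp-≈ x y x≈y = subst₂ _<_ (at _) (at _)
  where
  at : ∀ u → x ⟨$⟩ˡ u ≡ y ⟨$⟩ˡ u
  at u = sym (position-unique y (trans (sym (x≈y _)) (inverseʳ x)))

-- No position lies strictly between `q` and `r`, so any third position compares alike with both.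
transpose-< : {q r : Fin n} → Next q r → ∀ i j → i < j →
              (i ≡ q × j ≡ r) ⊎ PC.transpose q r i < PC.transpose q r j
transpose-< {q = q} {r} nx i j i<j = go
  where
  q<r : q < r
  q<r = next⇒< nx
  beyond : ∀ {k} → q < k → k ≢ r → r < k
  beyond {k} q<k k≢r = ℕₚ.≤∧≢⇒< (subst (ℕ._≤ toℕ k) (sym nx) q<k)
    (λ e → k≢r (sym (toℕ-injective e)))
  below : ∀ {k} → k < r → k ≢ q → k < q
  below {k} k<r k≢q = ℕₚ.≤∧≢⇒< (ℕₚ.≤-pred (subst (toℕ k ℕ.<_) nx k<r))
    (λ e → k≢q (toℕ-injective e))
  go : (i ≡ q × j ≡ r) ⊎ PC.transpose q r i < PC.transpose q r j
  go with i ≟ q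
  go | yes refl with j ≟ q
  ... | yes refl = contradiction i<j (ℕₚ.<-irrefl refl)
  ... | no _ with j ≟ r
  ...   | yes j≡r = inj₁ (refl , j≡r)
  ...   | no j≢r  = inj₂ (beyond i<j j≢r)
  go | no i≢q with i ≟ r
  go | no i≢q | yes refl with j ≟ q
  ... | yes refl = contradiction i<j (ℕₚ.<-asym q<r)
  ... | no _ with j ≟ r
  ...   | yes refl = contradiction i<j (ℕₚ.<-irrefl refl)
  ...   | no _     = inj₂ (ℕₚ.<-trans q<r i<j)
  go | no i≢q | no i≢r with j ≟ q
  ... | yes refl = inj₂ (ℕₚ.<-trans i<j q<r)
  ... | no _ with j ≟ r
  ...   | yes refl = inj₂ (below i<j i≢q)
  ...   | no _     = inj₂ i<j

-- A move reorders a single pair of values, so each order relation of an invariant is in danger only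
-- when it concerns that very pair.
≺-swapAt : (x z : Permutation′ n) {q r : Fin n} → Next q r → z ≈ swapAt q r x →
           ∀ {u v} → u ≺[ x ] v →
           (u ≡ x ⟨$⟩ʳ q × v ≡ x ⟨$⟩ʳ r) ⊎ u ≺[ z ] v
≺-swapAt x z {q} {r} nx e {u} {v} u≺v with transpose-< nx _ _ u≺v
... | inj₁ (i≡q , j≡r) =
      inj₁ (trans (sym (inverseʳ x)) (cong (x ⟨$⟩ʳ_) i≡q) ,
            trans (sym (inverseʳ x)) (cong (x ⟨$⟩ʳ_) j≡r))
... | inj₂ lt = inj₂ (subst₂ _<_ (sym (at u)) (sym (at v)) lt)
  where
  at : ∀ w → z ⟨$⟩ˡ w ≡ PC.transpose q r (x ⟨$⟩ˡ w)
  at w = position-unique z (trans (e _)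
    (trans (cong (x ⟨$⟩ʳ_) (transpose-invol q r (x ⟨$⟩ˡ w))) (inverseʳ x)))

-- The invariant of the congruence classes.

-- The values in (a, d) that stand left of d are those up to the threshold b;
-- c only witnesses that some stand right of a.
record Separated (x : Permutation′ n) : Set where
  constructor separated
  field
    a b c d : Fin n
    a<b     : a < b
    b<c     : b < c
    c<d     : c < d
    d≺a     : d ≺[ x ] a
    low     : ∀ v → a < v → v ≤ b → v ≺[ x ] d
    high    : ∀ v → b < v → v < d → a ≺[ x ] v

  -- If `v < u`, then `v`, standing right of `d`, exceeds `b`; so does `u`, which `high` then puts
  -- right of `a`. This is applied to the two outer entries of a move.
  ascending : ∀ {u v} → u ≺[ x ] a → d ≺[ x ] v → a < v → u < d → ¬ v < u
  ascending {u} {v} u≺a d≺v a<v u<d v<u with ℕₚ.≤-<-connex (toℕ v) (toℕ b)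
  ... | inj₁ v≤b = ℕₚ.<-asym (low v a<v v≤b) d≺v
  ... | inj₂ b<v = ℕₚ.<-asym (high u (ℕₚ.<-trans b<v v<u) u<d) u≺a

separated-≈ : (x y : Permutation′ n) → x ≈ y → Separated x → Separated y
separated-≈ x y x≈y (separated a b c d a<b b<c c<d d≺a low high) =
  separated a b c d a<b b<c c<d (≺-resp-≈ x y x≈y d≺a)
    (λ v a<v v≤b → ≺-resp-≈ x y x≈y (low v a<v v≤b))
    (λ v b<v v<d → ≺-resp-≈ x y x≈y (high v b<v v<d))

-- The move undoes a descent, whereas the pairs in `low` and `high` are ascents. If it exchanged `d`
-- and `a`, the outer entries of its pattern would contradict `ascending`.
separated-down : (y x : Permutation′ n) → y ⟶ x → Separated y → Separated x
separated-down y x (q , r , (nx , p , s , p<q , r<s , ab , bc , cd) , e)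
  S@(separated a b c d a<b b<c c<d d≺a low high) =
  separated a b c d a<b b<c c<d d≺a′ low′ high′
  where
  open Separated S using (ascending)
  q<r : q < r
  q<r = next⇒< nx
  r<q : (y ⟨$⟩ʳ r) < (y ⟨$⟩ʳ q)
  r<q = ℕₚ.<-trans ab (ℕₚ.<-trans bc cd)
  d≺a′ : d ≺[ x ] a
  d≺a′ with ≺-swapAt y x nx e d≺a
  ... | inj₂ lt = lt
  ... | inj₁ (refl , refl) = contradiction bc
        (ascending (<⇒≺ y (ℕₚ.<-trans p<q q<r)) (<⇒≺ y (ℕₚ.<-trans q<r r<s)) ab cd)
  low′ : ∀ v → a < v → v ≤ b → v ≺[ x ] d
  low′ v a<v v≤b with ≺-swapAt y x nx e (low v a<v v≤b)
  ... | inj₂ lt = lt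
  ... | inj₁ (refl , refl) = contradiction r<q
        (ℕₚ.<-asym (ℕₚ.≤-<-trans v≤b (ℕₚ.<-trans b<c c<d)))
  high′ : ∀ v → b < v → v < d → a ≺[ x ] v
  high′ v b<v v<d with ≺-swapAt y x nx e (high v b<v v<d)
  ... | inj₂ lt = lt
  ... | inj₁ (refl , refl) = contradiction r<q (ℕₚ.<-asym (ℕₚ.<-trans a<b b<v))

-- The exchanged pair is now an ascent, so `d` and `a` keep their order. If it is a pair from `low`
-- or `high`, the outer entries have values between `a` and `d` and contradict `ascending`.
separated-up : (x y : Permutation′ n) → y ⟶ x → Separated x → Separated y
separated-up x y (q , r , (nx , p , s , p<q , r<s , ab , bc , cd) , e)
  S@(separated a b c d a<b b<c c<d d≺a low high) =
  separated a b c d a<b b<c c<d d≺a′ low′ high′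
  where
  open Separated S using (ascending)
  open Unswap x y e
  q<r : q < r
  q<r = next⇒< nx
  xp = before q<r p<q
  xs = after q<r r<s
  q<s′ : (x ⟨$⟩ʳ q) < (x ⟨$⟩ʳ s)
  q<s′ = subst₂ _<_ (sym at-l) (sym xs) ab
  s<p′ : (x ⟨$⟩ʳ s) < (x ⟨$⟩ʳ p)
  s<p′ = subst₂ _<_ (sym xs) (sym xp) bc
  p<r′ : (x ⟨$⟩ʳ p) < (x ⟨$⟩ʳ r)
  p<r′ = subst₂ _<_ (sym xp) (sym at-r) cd
  d≺a′ : d ≺[ y ] a
  d≺a′ with ≺-swapAt x y nx unswap d≺a
  ... | inj₂ lt = lt
  ... | inj₁ (refl , refl) = contradiction
        (ℕₚ.<-trans q<s′ (ℕₚ.<-trans s<p′ p<r′))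
        (ℕₚ.<-asym (ℕₚ.<-trans a<b (ℕₚ.<-trans b<c c<d)))
  low′ : ∀ v → a < v → v ≤ b → v ≺[ y ] d
  low′ v a<v v≤b with ≺-swapAt x y nx unswap (low v a<v v≤b)
  ... | inj₂ lt = lt
  ... | inj₁ (refl , refl) = contradiction s<p′
        (ascending (ℕₚ.<-trans (<⇒≺ x (ℕₚ.<-trans p<q q<r)) d≺a)
          (<⇒≺ x r<s) (ℕₚ.<-trans a<v q<s′) p<r′)
  high′ : ∀ v → b < v → v < d → a ≺[ y ] v
  high′ v b<v v<d with ≺-swapAt x y nx unswap (high v b<v v<d)
  ... | inj₂ lt = lt
  ... | inj₁ (refl , refl) = contradiction s<p′
        (ascending (<⇒≺ x p<q)
          (ℕₚ.<-trans d≺a (<⇒≺ x (ℕₚ.<-trans q<r r<s)))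
          q<s′ (ℕₚ.<-trans p<r′ v<d))

separated-Θ : (x y : Permutation′ n) → Θ₃₄₁₂ x y → Separated x → Separated y
separated-Θ x y ε S = S
separated-Θ x y (_◅_ {j = z} (fwd (inj₁ e)) gs) S =
  separated-Θ z y gs (separated-≈ x z e S)
separated-Θ x y (_◅_ {j = z} (fwd (inj₂ g)) gs) S =
  separated-Θ z y gs (separated-down x z g S)
separated-Θ x y (_◅_ {j = z} (bwd (inj₁ e)) gs) S =
  separated-Θ z y gs (separated-≈ x z (λ k → sym (e k)) S)
separated-Θ x y (_◅_ {j = z} (bwd (inj₂ g)) gs) S =
  separated-Θ z y gs (separated-up x z g S)

separated⇒2-41-3 : (x : Permutation′ n) → Separated x → Contains2-41-3 x
separated⇒2-41-3 x (separated a b c d a<b b<c c<d d≺a low high)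
  with crossing (λ p → d ≤? (x ⟨$⟩ʳ p)) (x ⟨$⟩ˡ d) (x ⟨$⟩ˡ a) d≺a
         (ℕₚ.≤-reflexive (cong toℕ (sym (inverseʳ x))))
         (λ d≤a → ℕₚ.<⇒≱ (ℕₚ.<-trans a<b (ℕₚ.<-trans b<c c<d))
           (subst (d ≤_) (inverseʳ x) d≤a))
... | q , r , nx , D≤q , r≤A , d≤xq , d≰xr =
  -- `b` and `c` themselves serve as the 2 and the 3.
  q , r , nx , x ⟨$⟩ˡ b , x ⟨$⟩ˡ c ,
  ℕₚ.<-≤-trans (low b a<b ℕₚ.≤-refl) D≤q ,
  ℕₚ.≤-<-trans r≤A (high c b<c c<d) ,
  subst ((x ⟨$⟩ʳ r) <_) (sym (inverseʳ x)) (ℕₚ.≤-<-trans xr≤a a<b) ,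
  subst₂ _<_ (sym (inverseʳ x)) (sym (inverseʳ x)) b<c ,
  subst (_< (x ⟨$⟩ʳ q)) (sym (inverseʳ x)) (ℕₚ.<-≤-trans c<d d≤xq)
  where
  -- A value strictly between `a` and `d` would stand left of `d` or right of `a`, but position `r`
  -- is in neither place.
  xr≤a : (x ⟨$⟩ʳ r) ≤ a
  xr≤a = ℕₚ.≮⇒≥ λ a<xr → case a<xr (ℕₚ.≤-<-connex _ (toℕ b))
    where
    case : a < (x ⟨$⟩ʳ r) → (x ⟨$⟩ʳ r) ≤ b ⊎ b < (x ⟨$⟩ʳ r) → _
    case a<xr (inj₁ xr≤b) = ℕₚ.<-asym
      (ℕₚ.≤-<-trans D≤q (next⇒< nx))
      (subst (_< (x ⟨$⟩ˡ d)) (inverseˡ x) (low _ a<xr xr≤b))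
    case a<xr (inj₂ b<xr) = ℕₚ.<⇒≱
      (subst ((x ⟨$⟩ˡ a) <_) (inverseˡ x) (high _ b<xr (ℕₚ.≰⇒> d≰xr))) r≤A

-- Spread occurrences of 2-41-3 and their narrowing.

-- A 2-41-3 whose 4 and 1 need not be adjacent: the positions B, D, A, C carry
-- the entries b, d, a, c.
record Spread (x : Permutation′ n) : Set where
  constructor spread
  field
    B D A C : Fin n
    B<D     : B < D
    D<A     : D < A
    A<C     : A < C
    a<b     : (x ⟨$⟩ʳ A) < (x ⟨$⟩ʳ B)
    b<c     : (x ⟨$⟩ʳ B) < (x ⟨$⟩ʳ C)
    c<d     : (x ⟨$⟩ʳ C) < (x ⟨$⟩ʳ D)
    side    : ∀ p → (x ⟨$⟩ʳ A) < (x ⟨$⟩ʳ p) → (x ⟨$⟩ʳ p) < (x ⟨$⟩ʳ D) →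
              p < D ⊎ A < p

  -- The measure for the termination of the narrowing.
  gap : ℕ
  gap = toℕ (x ⟨$⟩ʳ D) ∸ toℕ (x ⟨$⟩ʳ A)

  -- The obstruction to a threshold between the values left of `D` and those right of `A`; for
  -- adjacent `D` and `A` it is a 3-41-2.
  Mixed : Fin n → Fin n → Set
  Mixed p s = p < D × A < s ×
    (x ⟨$⟩ʳ A) < (x ⟨$⟩ʳ s) × (x ⟨$⟩ʳ s) < (x ⟨$⟩ʳ p) × (x ⟨$⟩ʳ p) < (x ⟨$⟩ʳ D)

2-41-3⇒spread : (x : Permutation′ n) → ∀ {q r} → Occ2-41-3 x q r → Spread x
2-41-3⇒spread x {q} {r} (nx , p , s , p<q , r<s , ab , bc , cd) =
  spread p q r s p<q (next⇒< nx) r<s ab bc cd side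
  where
  side : ∀ p → (x ⟨$⟩ʳ r) < (x ⟨$⟩ʳ p) → (x ⟨$⟩ʳ p) < (x ⟨$⟩ʳ q) → p < q ⊎ r < p
  side p a<p p<d with ℕₚ.<-cmp (toℕ p) (toℕ q)
  ... | tri< p<q _ _ = inj₁ p<q
  ... | tri≈ _ e _ rewrite toℕ-injective e = contradiction p<d (ℕₚ.<-irrefl refl)
  ... | tri> _ _ q<p = inj₂ (ℕₚ.≤∧≢⇒< (subst (ℕ._≤ toℕ p) (sym nx) q<p)
        (λ e → ℕₚ.<-irrefl (cong (λ k → toℕ (x ⟨$⟩ʳ k)) (toℕ-injective e)) a<p))

-- The threshold is the greatest entry with value between those at `A` and `D` that stands left of
-- `D`. A smaller such entry right of `A` would form a mixed pair with it.
unmixed⇒separated : (x : Permutation′ n) (S : Spread x) →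
                    (∀ p s → ¬ Spread.Mixed S p s) → Separated x
unmixed⇒separated x (spread B D A C B<D D<A A<C a<b b<c c<d side) unmixed
  with extremal (On.wellFounded (x ⟨$⟩ʳ_) >-wellFounded)
         (λ m k → (x ⟨$⟩ʳ k) <? (x ⟨$⟩ʳ m))
         (λ p → (p <? D) ×-dec ((x ⟨$⟩ʳ A) <? (x ⟨$⟩ʳ p))
                  ×-dec ((x ⟨$⟩ʳ p) <? (x ⟨$⟩ʳ D)))
         B (B<D , a<b , ℕₚ.<-trans b<c c<d)
... | T , (T<D , a<t , t<d) , greatest =
  separated (x ⟨$⟩ʳ A) (x ⟨$⟩ʳ T) (x ⟨$⟩ʳ C) (x ⟨$⟩ʳ D) a<t t<c c<d (<⇒≺ x D<A)
    (λ v → subst (λ v → (x ⟨$⟩ʳ A) < v → v ≤ (x ⟨$⟩ʳ T) → v ≺[ x ] (x ⟨$⟩ʳ D))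
             (inverseʳ x) (low (x ⟨$⟩ˡ v)))
    (λ v → subst (λ v → (x ⟨$⟩ʳ T) < v → v < (x ⟨$⟩ʳ D) → (x ⟨$⟩ʳ A) ≺[ x ] v)
             (inverseʳ x) (high (x ⟨$⟩ˡ v)))
  where
  T<A : T < A
  T<A = ℕₚ.<-trans T<D D<A
  t<c : (x ⟨$⟩ʳ T) < (x ⟨$⟩ʳ C)
  t<c = ≢∧≮⇒> (entry-≢ x (>⇒≢ (ℕₚ.<-trans T<A A<C)))
    (λ c<t → unmixed T C (T<D , A<C , ℕₚ.<-trans a<b b<c , c<t , t<d))
  low : ∀ p → (x ⟨$⟩ʳ A) < (x ⟨$⟩ʳ p) → (x ⟨$⟩ʳ p) ≤ (x ⟨$⟩ʳ T) →
        (x ⟨$⟩ʳ p) ≺[ x ] (x ⟨$⟩ʳ D)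
  low p a<p p≤t with side p a<p (ℕₚ.≤-<-trans p≤t t<d)
  ... | inj₁ p<D = <⇒≺ x p<D
  ... | inj₂ A<p = contradiction
        (T<D , A<p , a<p
        , ≢∧≮⇒> (entry-≢ x (<⇒≢ (ℕₚ.<-trans T<A A<p))) (ℕₚ.≤⇒≯ p≤t) , t<d)
        (unmixed T p)
  high : ∀ p → (x ⟨$⟩ʳ T) < (x ⟨$⟩ʳ p) → (x ⟨$⟩ʳ p) < (x ⟨$⟩ʳ D) →
         (x ⟨$⟩ʳ A) ≺[ x ] (x ⟨$⟩ʳ p)
  high p t<p p<d with side p (ℕₚ.<-trans a<t t<p) p<d
  ... | inj₁ p<D = contradiction (p<D , ℕₚ.<-trans a<t t<p , p<d) (greatest p t<p)
  ... | inj₂ A<p = <⇒≺ x A<p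

-- The last c′ > c to the left of d takes the place of d: after an entry below c
-- between c′ and d, the ascent back to d would complete a 3-14-2.
lower-d : (x : Permutation′ n) → ¬ Contains3-14-2 x → (S : Spread x) →
          let open Spread S in
          ∀ U → U < D → (x ⟨$⟩ʳ C) < (x ⟨$⟩ʳ U) → (x ⟨$⟩ʳ U) < (x ⟨$⟩ʳ D) →
          Σ[ S′ ∈ Spread x ] Spread.gap S′ ℕ.< gap
lower-d x no3142 (spread B D A C B<D D<A A<C a<b b<c c<d side) U₀ U₀<D c<u₀ u₀<d
  with extremal >-wellFounded (λ m k → k <? m)
         (λ p → (p <? D) ×-dec ((x ⟨$⟩ʳ C) <? (x ⟨$⟩ʳ p))
                  ×-dec ((x ⟨$⟩ʳ p) <? (x ⟨$⟩ʳ D)))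
         U₀ (U₀<D , c<u₀ , u₀<d)
... | U , (U<D , c<u , u<d) , last =
  spread B U A C B<U (ℕₚ.<-trans U<D D<A) A<C a<b b<c c<u side′ ,
  ℕₚ.∸-monoˡ-< u<d (ℕₚ.<⇒≤ (ℕₚ.<-trans a<b (ℕₚ.<-trans b<c c<u)))
  where
  D<C : D < C
  D<C = ℕₚ.<-trans D<A A<C
  none : ∀ p → U < p → p < D → ¬ (x ⟨$⟩ʳ p) < (x ⟨$⟩ʳ C)
  none p U<p p<D p<c
    with crossing (λ p → (x ⟨$⟩ʳ p) <? (x ⟨$⟩ʳ C)) p D p<D p<c (ℕₚ.<-asym c<d)
  ... | q , r , nx , p≤q , r≤D , q<c , r≮c =
    no3142 (q , r , nx , U , C , U<q , r<C , q<c , c<u , ℕₚ.<-≤-trans u<d d≤r)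
    where
    U<q : U < q
    U<q = ℕₚ.<-≤-trans U<p p≤q
    r<C : r < C
    r<C = ℕₚ.≤-<-trans r≤D D<C
    c<r : (x ⟨$⟩ʳ C) < (x ⟨$⟩ʳ r)
    c<r = ≢∧≮⇒> (entry-≢ x (<⇒≢ r<C)) r≮c
    -- Otherwise `r` would be a later candidate than `U`.
    d≤r : (x ⟨$⟩ʳ D) ≤ (x ⟨$⟩ʳ r)
    d≤r = ℕₚ.≮⇒≥ λ r<d → last r (ℕₚ.<-trans U<q (next⇒< nx))
      ( ℕₚ.≤∧≢⇒< r≤D (λ e → ℕₚ.<-irrefl
          (cong (λ k → toℕ (x ⟨$⟩ʳ k)) (toℕ-injective e)) r<d)
      , c<r , r<d)
  -- The entry at `B` is itself below the one at `C`, so `none` keeps it from standing between `U`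
  -- and `D`.
  B<U : B < U
  B<U = ≢∧≮⇒> (λ { refl → ℕₚ.<-asym b<c c<u }) (λ U<B → none B U<B B<D b<c)
  side′ : ∀ p → (x ⟨$⟩ʳ A) < (x ⟨$⟩ʳ p) → (x ⟨$⟩ʳ p) < (x ⟨$⟩ʳ U) → p < U ⊎ A < p
  side′ p a<p p<u with side p a<p (ℕₚ.<-trans p<u u<d)
  ... | inj₂ A<p = inj₂ A<p
  ... | inj₁ p<D = inj₁ (≢∧≮⇒> (λ { refl → ℕₚ.<-irrefl refl p<u })
        (λ U<p → last p U<p (p<D ,
          ≢∧≮⇒> (entry-≢ x (<⇒≢ (ℕₚ.<-trans p<D D<C))) (none p U<p p<D) ,
          ℕₚ.<-trans p<u u<d)))

-- The mirror image of lower-d under reverse-complement.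
raise-a : (x : Permutation′ n) → ¬ Contains3-14-2 x → (S : Spread x) →
          let open Spread S in
          ∀ V → A < V → (x ⟨$⟩ʳ A) < (x ⟨$⟩ʳ V) → (x ⟨$⟩ʳ V) < (x ⟨$⟩ʳ B) →
          Σ[ S′ ∈ Spread x ] Spread.gap S′ ℕ.< gap
raise-a x no3142 (spread B D A C B<D D<A A<C a<b b<c c<d side) V₀ A<V₀ a<v₀ v₀<b
  with extremal <-wellFounded _<?_
         (λ p → (A <? p) ×-dec ((x ⟨$⟩ʳ A) <? (x ⟨$⟩ʳ p))
                  ×-dec ((x ⟨$⟩ʳ p) <? (x ⟨$⟩ʳ B)))
         V₀ (A<V₀ , a<v₀ , v₀<b)
... | V , (A<V , a<v , v<b) , first =
  spread B D V C B<D (ℕₚ.<-trans D<A A<V) V<C v<b b<c c<d side′ ,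
  ℕₚ.∸-monoʳ-< a<v (ℕₚ.<⇒≤ (ℕₚ.<-trans v<b (ℕₚ.<-trans b<c c<d)))
  where
  B<A : B < A
  B<A = ℕₚ.<-trans B<D D<A
  none : ∀ p → A < p → p < V → ¬ (x ⟨$⟩ʳ B) < (x ⟨$⟩ʳ p)
  none p A<p p<V b<p
    with crossing (λ p → (x ⟨$⟩ʳ p) <? (x ⟨$⟩ʳ B)) A p A<p a<b (ℕₚ.<-asym b<p)
  ... | q , r , nx , A≤q , r≤p , q<b , r≮b =
    no3142 (q , r , nx , B , V , B<q , r<V , ℕₚ.≤-<-trans q≤a a<v , v<b , b<r)
    where
    B<q : B < q
    B<q = ℕₚ.<-≤-trans B<A A≤q
    r<V : r < V
    r<V = ℕₚ.≤-<-trans r≤p p<V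
    b<r : (x ⟨$⟩ʳ B) < (x ⟨$⟩ʳ r)
    b<r = ≢∧≮⇒> (entry-≢ x (>⇒≢ (ℕₚ.<-trans B<q (next⇒< nx)))) r≮b
    q≤a : (x ⟨$⟩ʳ q) ≤ (x ⟨$⟩ʳ A)
    q≤a = ℕₚ.≮⇒≥ λ a<q → first q (ℕₚ.<-trans (next⇒< nx) r<V)
      ( ℕₚ.≤∧≢⇒< A≤q (λ e → ℕₚ.<-irrefl
          (cong (λ k → toℕ (x ⟨$⟩ʳ k)) (toℕ-injective e)) a<q)
      , a<q , q<b)
  V<C : V < C
  V<C = ≢∧≮⇒> (λ { refl → ℕₚ.<-asym v<b b<c }) (λ C<V → none C A<C C<V b<c)
  side′ : ∀ p → (x ⟨$⟩ʳ V) < (x ⟨$⟩ʳ p) → (x ⟨$⟩ʳ p) < (x ⟨$⟩ʳ D) → p < D ⊎ V < p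
  side′ p v<p p<d with side p (ℕₚ.<-trans a<v v<p) p<d
  ... | inj₁ p<D = inj₁ p<D
  ... | inj₂ A<p = inj₂ (≢∧≮⇒> (λ { refl → ℕₚ.<-irrefl refl v<p })
        (λ p<V → first p p<V (A<p , ℕₚ.<-trans a<v v<p ,
          ≢∧≮⇒> (entry-≢ x (<⇒≢ (ℕₚ.<-trans B<A A<p))) (none p A<p p<V))))

-- While a mixed pair exists, its larger entry lies either above the entry at `C`, and `lower-d`
-- applies, or below it, and `raise-a` applies; the gap shrinks each time.
spread⇒separated : (x : Permutation′ n) → ¬ Contains3-14-2 x → Spread x → Separated x
spread⇒separated x no3142 S = go S (ℕᵢ.<-wellFounded (Spread.gap S))
  where
  go : (S : Spread x) → Acc ℕ._<_ (Spread.gap S) → Separated x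
  go S (acc rec)
    with any? (λ p → any? (λ s → (p <? D) ×-dec (A <? s) ×-dec
           ((x ⟨$⟩ʳ A) <? (x ⟨$⟩ʳ s)) ×-dec ((x ⟨$⟩ʳ s) <? (x ⟨$⟩ʳ p)) ×-dec
           ((x ⟨$⟩ʳ p) <? (x ⟨$⟩ʳ D))))
    where open Spread S
  ... | no none = unmixed⇒separated x S (λ p s m → none (p , s , m))
  ... | yes (p , s , p<D , A<s , a<s , s<p , p<d)
    with ℕₚ.≤-<-connex (toℕ (x ⟨$⟩ʳ p)) (toℕ (x ⟨$⟩ʳ Spread.C S))
  ...   | inj₂ c<p with lower-d x no3142 S p p<D c<p p<d
  ...     | S′ , smaller = go S′ (rec smaller)
  go (spread B D A C B<D D<A A<C a<b b<c c<d side) (acc rec)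
      | yes (p , s , p<D , A<s , a<s , s<p , p<d) | inj₁ p≤c
    -- Putting `p` in the place of `B` leaves the gap unchanged and makes the entry at `s` smaller
    -- than the new 2, as `raise-a` requires.
    with raise-a x no3142
           (spread p D A C p<D D<A A<C (ℕₚ.<-trans a<s s<p)
             (≢∧≮⇒> (entry-≢ x (>⇒≢ (ℕₚ.<-trans p<D (ℕₚ.<-trans D<A A<C))))
               (ℕₚ.≤⇒≯ p≤c))
             c<d side)
           s A<s a<s s<p
  ... | S′ , smaller = go S′ (rec smaller)

-- The 4 and the 1 are adjacent, so a mixed pair would complete them to a 3-41-2.
3-41-2-avoiding⇒separated : (x : Permutation′ n) → ¬ Contains3-41-2 x →
                            Contains2-41-3 x → Separated x
3-41-2-avoiding⇒separated x no3412 (q , r , occ@(nx , _)) =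
  unmixed⇒separated x (2-41-3⇒spread x occ)
    (λ p s (p<q , r<s , r<s′ , s<p , p<q′) →
      no3412 (q , r , nx , p , s , p<q , r<s , r<s′ , s<p , p<q′))

3-14-2-avoiding⇒separated : (x : Permutation′ n) → ¬ Contains3-14-2 x →
                            Contains2-41-3 x → Separated x
3-14-2-avoiding⇒separated x no3142 (q , r , occ) =
  spread⇒separated x no3142 (2-41-3⇒spread x occ)

-- Normal forms, pattern avoidance and the bijection.

3-41-2⇒redex : (x : Permutation′ n) {q r : Fin n} → Occ3-41-2 x q r → Down.Redex x q r
3-41-2⇒redex x (nx , p , s , p<q , r<s , ab , bc , cd) =
  nx , p , s , p<q , r<s , ℕₚ.<-trans ab bc , cd , ab , ℕₚ.<-trans bc cd , bc

redex⇒3-41-2 : (x : Permutation′ n) {q r : Fin n} → Down.Redex x q r → Occ3-41-2 x q r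
redex⇒3-41-2 x (nx , p , s , p<q , r<s , _ , cd , ab , _ , bc) =
  nx , p , s , p<q , r<s , ab , bc , cd

3-14-2⇒redex : (x : Permutation′ n) {q r : Fin n} → Occ3-14-2 x q r → Up.Redex x q r
3-14-2⇒redex x (nx , p , s , p<q , r<s , ab , bc , cd) =
  nx , p , s , p<q , r<s , rev-< cd , rev-< (ℕₚ.<-trans ab bc) ,
  rev-< (ℕₚ.<-trans bc cd) , rev-< ab , bc

redex⇒3-14-2 : (x : Permutation′ n) {q r : Fin n} → Up.Redex x q r → Occ3-14-2 x q r
redex⇒3-14-2 x (nx , p , s , p<q , r<s , dc , _ , _ , ba , bc) =
  nx , p , s , p<q , r<s , unrev-< ba , bc , unrev-< dc

π↓-avoids-3-41-2 : (x : Permutation′ n) → ¬ Contains3-41-2 (π↓ x)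
π↓-avoids-3-41-2 x (q , r , occ) =
  Down.NormalForm.normal (Down.normalForm x) q r (3-41-2⇒redex (π↓ x) occ)

π↑-avoids-3-14-2 : (x : Permutation′ n) → ¬ Contains3-14-2 (π↑ x)
π↑-avoids-3-14-2 x (q , r , occ) =
  Up.NormalForm.normal (Up.normalForm x) q r (3-14-2⇒redex (π↑ x) occ)

π↓-cong : (x y : Permutation′ n) → Θ₃₄₁₂ x y → π↓ x ≈ π↓ y
π↓-cong x y xΘy = Down.nf-Eq x y (Θ⇒down x y xΘy)

π↑-cong : (x y : Permutation′ n) → Θ₃₄₁₂ x y → π↑ x ≈ π↑ y
π↑-cong x y xΘy = Up.nf-Eq x y (Θ⇒up x y xΘy)

π↓-fixes : (x : Permutation′ n) → ¬ Contains3-41-2 x → x ≈ π↓ x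
π↓-fixes x no3412 = Down.normal-↠ x (π↓ x)
  (λ q r rx → no3412 (q , r , redex⇒3-41-2 x rx))
  (Down.NormalForm.reaches (Down.normalForm x))

π↑-fixes : (x : Permutation′ n) → ¬ Contains3-14-2 x → x ≈ π↑ x
π↑-fixes x no3142 = Up.normal-↠ x (π↑ x)
  (λ q r rx → no3142 (q , r , redex⇒3-14-2 x rx))
  (Up.NormalForm.reaches (Up.normalForm x))

π↓-Θ : (x : Permutation′ n) → Θ₃₄₁₂ (π↓ x) x
π↓-Θ x = symmetric _ (proj₁ (π↓-minimum x))

π↑-Θ : (x : Permutation′ n) → Θ₃₄₁₂ (π↑ x) x
π↑-Θ x = symmetric _ (proj₁ (π↑-maximum x))

-- A 2-41-3 in `π↓ x`, which avoids 3-41-2, yields a separated configuration; this passes through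
-- the class to `x` and forces a 2-41-3 there.
baxter⇒twisted : {x : Permutation′ n} → Baxter x → TwistedBaxter (π↓ x)
baxter⇒twisted {x = x} (_ , no2413) = π↓-avoids-3-41-2 x ,
  λ c → no2413 (separated⇒2-41-3 x (separated-Θ (π↓ x) x (π↓-Θ x)
    (3-41-2-avoiding⇒separated (π↓ x) (π↓-avoids-3-41-2 x) c)))

twisted⇒baxter : {x : Permutation′ n} → TwistedBaxter x → Baxter (π↑ x)
twisted⇒baxter {x = x} (_ , no2413) = π↑-avoids-3-14-2 x ,
  λ c → no2413 (separated⇒2-41-3 x (separated-Θ (π↑ x) x (π↑-Θ x)
    (3-14-2-avoiding⇒separated (π↑ x) (π↑-avoids-3-14-2 x) c)))

theorem8p2 : (n : ℕ) → n ≥ 1 →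
    Σ[ ↓-twisted ∈ (∀ {x : Permutation′ n} → Baxter x → TwistedBaxter (π↓ x)) ]
    Σ[ ↑-baxter ∈ (∀ {x : Permutation′ n} → TwistedBaxter x → Baxter (π↑ x)) ]
    IsBijection (_≋_ {P = Baxter}) (_≋_ {P = TwistedBaxter}) (map π↓ ↓-twisted)
    × IsInverse (_≋_ {P = Baxter}) (_≋_ {P = TwistedBaxter}) (map π↓ ↓-twisted) (map π↑ ↑-baxter)
theorem8p2 n _ = baxter⇒twisted , twisted⇒baxter ,
  record
    { isInjection = record
        { isCongruent = isCongruent
        ; injective   = λ {x} {y} → ↓-injective {x} {y}
        }
    ; surjective = λ y → ↑ y , λ {x} → ↓-inverseˡ {y} {x}
    } ,
  record
    { isLeftInverse = record
        { isCongruent = isCongruent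
        ; from-cong   = λ {x} {y} x≋y →
            π↑-cong (proj₁ x) (proj₁ y) (fwd (inj₁ x≋y) ◅ ε)
        ; inverseˡ    = λ {y} {x} → ↓-inverseˡ {y} {x}
        }
    -- `y` lies in the class of `x`, and `x`, avoiding 3-14-2, is the maximum of that class.
    ; inverseʳ = λ {x} {y} y≋↓x k →
        trans (π↑-cong (proj₁ y) (proj₁ x)
                (fwd (inj₁ y≋↓x) ◅ π↓-Θ (proj₁ x)) k)
              (sym (π↑-fixes (proj₁ x) (proj₁ (proj₂ x)) k))
    }
  where
  ↓ : Σ[ x ∈ Permutation′ n ] Baxter x → Σ[ x ∈ Permutation′ n ] TwistedBaxter x
  ↓ = map π↓ baxter⇒twisted
  ↑ : Σ[ x ∈ Permutation′ n ] TwistedBaxter x → Σ[ x ∈ Permutation′ n ] Baxter x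
  ↑ = map π↑ twisted⇒baxter

  ≋-isEquivalence : {P : Pred (Permutation′ n) 0ℓ} → IsEquivalence (_≋_ {P = P})
  ≋-isEquivalence = record
    { refl  = λ k → refl
    ; sym   = λ e k → sym (e k)
    ; trans = λ e f k → trans (e k) (f k)
    }

  isCongruent : IsCongruent (_≋_ {P = Baxter}) (_≋_ {P = TwistedBaxter}) ↓
  isCongruent = record
    { cong           = λ {x} {y} x≋y →
        π↓-cong (proj₁ x) (proj₁ y) (fwd (inj₁ x≋y) ◅ ε)
    ; isEquivalence₁ = ≋-isEquivalence
    ; isEquivalence₂ = ≋-isEquivalence
    }

  -- Equal images place `x` and `y` in one class, and both are its maximum.
  ↓-injective : ∀ {x y} → ↓ x ≋ ↓ y → x ≋ y
  ↓-injective {x , bx , _} {y , by , _} ↓x≋↓y k =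
    trans (π↑-fixes x bx k)
      (trans (π↑-cong x y
               (proj₁ (π↓-minimum x) ◅◅ fwd (inj₁ ↓x≋↓y) ◅ π↓-Θ y) k)
             (sym (π↑-fixes y by k)))

  ↓-inverseˡ : ∀ {y x} → x ≋ ↑ y → ↓ x ≋ y
  ↓-inverseˡ {y , ty , _} {x , _} x≋↑y k =
    trans (π↓-cong x y (fwd (inj₁ x≋↑y) ◅ π↑-Θ y) k) (sym (π↓-fixes y ty k))
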